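{- For every integer $k\geq 3$, $$\operatorname{gr}_k(P_5:S_4^1)= \begin{cases} 17, & k=3;\\ 6, & k=4;\\ 5, & k=5,6;\\ \ell, & \binom{\ell-1}{2}+1\leq k\leq \binom{\ell}{2}\ \text{ for an integer } \ell\geq 5. \end{cases}$$
   Context: All graphs are finite, simple and undirected. $K_n$ is the complete graph on $n$ vertices and $P_5$ is the path with $5$ vertices and $4$ edges. $S_t^r$ is the graph of order $t$ obtained from the star $K_{1,t-1}$ by adding $r$ pairwise independent edges between the leaves; thus $S_4^1$ is a triangle with one pendent edge attached. A $k$-edge-coloring assigns to each edge one of $k$ colors; all $k$-edge-colorings are assumed exact, i.e. each of the $k$ colors is used at least once. An edge-colored graph is rainbow if all its edges have different colors and monochromatic if all its edges have a single color. A copy of a graph means a (not necessarily induced) subgraph isomorphic to it. For non-empty graphs $G,H$ (graphs with at least one edge) and a positive integer $k$, the Gallai-Ramsey number $\operatorname{gr}_k(G:H)$ is the minimum integer $N$ with $\binom{N}{2}\geq k$ (so that $K_N$ admits a $k$-edge-coloring) such that for all $n\geq N$, every $k$-edge-coloring of $K_n$ contains either a rainbow copy of $G$ or a monochromatic copy of $H$. -}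

module Defs where

open import Level using (0ℓ)
open import Data.Nat using (ℕ; zero; suc; _*_; _≤_; _<_)
import Data.Nat.Properties as ℕ
open import Data.Nat.Combinatorics using (_C_)
open import Data.Fin using (Fin; toℕ)
import Data.Fin.Properties as Fin
open import Data.Product using (Σ; ∃-syntax; _×_; _,_)
open import Data.Sum using (_⊎_; swap; [_,_]′)
open import Function using (_∘_)
open import Function.Definitions using (Injective)
open import Relation.Binary using (Rel; Symmetric; Irreflexive; Decidable)
open import Relation.Binary.PropositionalEquality using (_≡_; _≢_; refl; ≢-sym)
open import Relation.Nullary using (yes; no; ¬?)
open import Relation.Nullary.Decidable using (_×-dec_; _⊎-dec_; map′)

record Graph : Set₁ where
  field
    order    : ℕ
    Adj      : Rel (Fin order) 0ℓ
    adj-sym  : Symmetric Adj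
    adj-irr  : Irreflexive _≡_ Adj
    adj?     : Decidable Adj

  Vertex : Set
  Vertex = Fin order

open Graph using (order; Adj; Vertex)

K : ℕ → Graph
K n = record
  { order   = n
  ; Adj     = _≢_
  ; adj-sym = ≢-sym
  ; adj-irr = λ eq neq → neq eq
  ; adj?    = λ u v → ¬? (u Fin.≟ v)
  }

-- A simple graph on Fin n from a set of pairs (u , v) with u < v; each pair
-- is made into an undirected edge.
fromArcs : (n : ℕ) (A : Rel ℕ 0ℓ) → Decidable A → (∀ {i j} → A i j → i < j) → Graph
fromArcs n A A? A⇒< = record
  { order   = n
  ; Adj     = λ u v → A (toℕ u) (toℕ v) ⊎ A (toℕ v) (toℕ u)
  ; adj-sym = swap
  ; adj-irr = λ { refl → [ ℕ.<-irrefl refl ∘ A⇒< , ℕ.<-irrefl refl ∘ A⇒< ]′ }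
  ; adj?    = λ u v → A? (toℕ u) (toℕ v) ⊎-dec A? (toℕ v) (toℕ u)
  }

P : ℕ → Graph
P n = fromArcs n (λ i j → j ≡ suc i) (λ i j → j ℕ.≟ suc i) (λ { refl → ℕ.n<1+n _ })

-- S t r is the graph S_t^r, with centre 0 and leaves 1, …, t − 1; the added
-- independent edges are {1,2}, {3,4}, …, {2r−1,2r}.  It is the intended graph
-- when 2 * r < t, so that these leaves all exist.
data StarArc (r : ℕ) : Rel ℕ 0ℓ where
  spoke : ∀ {j} → StarArc r 0 (suc j)
  extra : ∀ {m} → m < r → StarArc r (suc (2 * m)) (suc (suc (2 * m)))

starArc? : ∀ r → Decidable (StarArc r)
starArc? r zero    zero    = no λ ()
starArc? r zero    (suc j) = yes spoke
starArc? r (suc i) j       =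
  map′ (λ { (m , m<r , refl , refl) → extra m<r })
       (λ { (extra {m} m<r) → m , m<r , refl , refl })
       (ℕ.anyUpTo? (λ m → (i ℕ.≟ 2 * m) ×-dec (j ℕ.≟ suc (suc (2 * m)))) r)

starArc-< : ∀ {r i j} → StarArc r i j → i < j
starArc-< spoke     = ℕ.0<1+n
starArc-< (extra _) = ℕ.n<1+n _

S : ℕ → ℕ → Graph
S t r = fromArcs t (StarArc r) (starArc? r) starArc-<

-- A not necessarily induced copy of H in G, given as an embedding of H onto
-- a subgraph of G.
record Copy (H G : Graph) : Set where
  field
    map     : Vertex H → Vertex G
    map-inj : Injective _≡_ _≡_ map
    map-adj : ∀ {u v} → Adj H u v → Adj G (map u) (map v)

-- The colour of an edge depends on neither the order of its ends nor the
-- proof of adjacency (which is irrelevant).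
record EdgeColouring (k : ℕ) (G : Graph) : Set where
  field
    colour     : (u v : Vertex G) → .(Adj G u v) → Fin k
    colour-sym : ∀ {u v} (e : Adj G u v) (e′ : Adj G v u) → colour u v e ≡ colour v u e′

restrict : ∀ {k G H} → EdgeColouring k G → Copy H G → EdgeColouring k H
restrict c f = record
  { colour     = λ u v e → colour (map u) (map v) (map-adj e)
  ; colour-sym = λ e e′ → colour-sym (map-adj e) (map-adj e′)
  }
  where open EdgeColouring c
        open Copy f

module _ {k : ℕ} {G : Graph} (c : EdgeColouring k G) where
  open EdgeColouring c

  Exact : Set
  Exact = ∀ (a : Fin k) → ∃[ u ] ∃[ v ] Σ (Adj G u v) λ e → colour u v e ≡ a

  -- Edges of the same colour coincide as unordered pairs.
  Rainbow : Set
  Rainbow = ∀ {u v x y} (e : Adj G u v) (e′ : Adj G x y) →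
            colour u v e ≡ colour x y e′ →
            (u ≡ x × v ≡ y) ⊎ (u ≡ y × v ≡ x)

  Monochromatic : Set
  Monochromatic = ∃[ a ] (∀ {u v} (e : Adj G u v) → colour u v e ≡ a)

-- N satisfies the condition whose least solution is gr_k(G : H).
GallaiRamseyBound : ℕ → Graph → Graph → ℕ → Set
GallaiRamseyBound k G H N =
  k ≤ N C 2 ×
  (∀ n → N ≤ n → (c : EdgeColouring k (K n)) → Exact c →
    (Σ (Copy G (K n)) λ f → Rainbow (restrict c f)) ⊎
    (Σ (Copy H (K n)) λ f → Monochromatic (restrict c f)))

-- gr_k(G : H) exists and equals N.  The notion is intended for k > 0 and for
-- G and H with at least one edge.
infix 4 gr[_,_∶_]≡_
gr[_,_∶_]≡_ : ℕ → Graph → Graph → ℕ → Set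
gr[ k , G ∶ H ]≡ N =
  GallaiRamseyBound k G H N × (∀ M → GallaiRamseyBound k G H M → N ≤ M)

{-# OPTIONS --safe #-}
module Submission where

-- With k = 3 there is no rainbow P₅, and the number is the three-colour Ramsey
-- number of the paw S₄¹: the upper bound is by induction on the number of
-- colours, the lower bound is the cubic-residue colouring over GF(16).
-- For k ≥ 4 the question is local.  Three colours on five vertices force a
-- rainbow P₄; from a rainbow P₄ and one further edge of a fourth colour (on six
-- vertices), or edges of a fourth and a fifth colour (on five), a case analysis
-- on few vertices always ends in a rainbow P₅ or a monochromatic paw.
-- The case analysis is done by evaluating a search procedure that is proved
-- sound.  For k ≥ 7 the bound k ≤ C(N , 2) is what makes the value minimal.

open import Defs
open import Data.Bool using (Bool; true; false; T; not; _∧_; _∨_; if_then_else_)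
open import Data.Bool.ListAction using (any; all)
open import Data.Bool.Properties using (T-∧; T-∨; T-≡)
open import Data.Empty using (⊥; ⊥-elim)
open import Data.Fin using (Fin; zero; suc; toℕ; fromℕ<; inject₁)
open import Data.Fin.Patterns using (0F; 1F; 2F; 3F; 4F; 5F)
import Data.Fin.Properties as Fin
open import Data.List using (List; []; _∷_; length; map; concatMap; upTo; _++_; filter; allFin)
open import Data.List.Membership.Propositional using (_∈_; find; lose)
open import Data.List.Membership.Propositional.Properties using (∈-filter⁺; ∈-filter⁻; ∈-allFin)
open import Data.List.Properties using (filter-all; filter-notAll; length-map; length-tabulate)
open import Data.List.Relation.Unary.All as All using (All; []; _∷_)
open import Data.List.Relation.Unary.All.Properties using (all⁺)
open import Data.List.Relation.Unary.AllPairs using ([]; _∷_; allPairs?)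
open import Data.List.Relation.Unary.Any as Any using (Any; here; there)
open import Data.List.Relation.Unary.Any.Properties using (any⁻)
open import Data.List.Relation.Unary.Unique.Propositional using (Unique)
import Data.List.Relation.Unary.Unique.Propositional.Properties as Unique
open import Data.Nat
open import Data.Nat.Combinatorics using (_C_; nC1≡n; nCk+nC[k+1]≡[n+1]C[k+1])
open import Data.Nat.Properties
open import Data.Product using (Σ; ∃₂; ∃-syntax; _×_; _,_; proj₁; proj₂)
open import Data.Sum using (_⊎_; inj₁; inj₂; [_,_]′)
open import Function using (_∘_; id; Equivalence)
open import Relation.Binary.Definitions using (tri<; tri≈; tri>)
open import Relation.Binary.PropositionalEquality
open import Relation.Nullary using (¬_; Dec; yes; no; contradiction; ¬?; _×-dec_)
open import Relation.Nullary.Decidable using (map′; _→-dec_; toWitness)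

-- Injections defined on an initial segment of ℕ

InjectiveBelow : ∀ {A : Set} → ℕ → (ℕ → A) → Set
InjectiveBelow m f = ∀ {i j} → i < m → j < m → f i ≡ f j → i ≡ j

module _ {A : Set} where

  -- Only the new value at `m` counts: indices beyond the bound in use carry junk, so overwriting
  -- all of them is harmless.
  _[_↦_] : (ℕ → A) → ℕ → A → ℕ → A
  (f [ m ↦ x ]) i = if i <ᵇ m then f i else x

  update-< : ∀ (f : ℕ → A) {m x i} → i < m → (f [ m ↦ x ]) i ≡ f i
  update-< f {m} {i = i} i<m with i <ᵇ m in eq
  ... | true  = refl
  ... | false = ⊥-elim (subst T eq (<⇒<ᵇ i<m))

  update-≡ : ∀ (f : ℕ → A) m {x} → (f [ m ↦ x ]) m ≡ x
  update-≡ f m with m <ᵇ m in eq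
  ... | true  = contradiction (<ᵇ⇒< m m (subst T (sym eq) _)) (<-irrefl refl)
  ... | false = refl

  update-injective : ∀ {f : ℕ → A} {m x} → InjectiveBelow m f → (∀ {i} → i < m → f i ≢ x) →
                     InjectiveBelow (suc m) (f [ m ↦ x ])
  update-injective {f} {m} f-inj f≢x i<1+m j<1+m eq
    with m<1+n⇒m<n∨m≡n i<1+m | m<1+n⇒m<n∨m≡n j<1+m
  ... | inj₁ i<m  | inj₁ j<m  = f-inj i<m j<m (trans (sym (update-< f i<m)) (trans eq (update-< f j<m)))
  ... | inj₁ i<m  | inj₂ refl = contradiction (trans (sym (update-< f i<m)) (trans eq (update-≡ f m))) (f≢x i<m)
  ... | inj₂ refl | inj₁ j<m  = contradiction (trans (sym (update-< f j<m)) (trans (sym eq) (update-≡ f m))) (f≢x j<m)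
  ... | inj₂ refl | inj₂ refl = refl

  at : A → List A → ℕ → A
  at x₀ []       _       = x₀
  at x₀ (x ∷ xs) zero    = x
  at x₀ (x ∷ xs) (suc i) = at x₀ xs i

  All-at : ∀ {P : A → Set} {x₀ xs i} → All P xs → i < length xs → P (at x₀ xs i)
  All-at {i = zero}  (p ∷ ps) _         = p
  All-at {i = suc i} (p ∷ ps) (s≤s i<n) = All-at ps i<n

  at-injective : ∀ {x₀ xs} → Unique xs → InjectiveBelow (length xs) (at x₀ xs)
  at-injective {xs = _ ∷ _} (x≢ ∷ u) {zero}  {zero}  _         _         eq = refl
  at-injective {xs = _ ∷ _} (x≢ ∷ u) {zero}  {suc j} _         (s≤s j<n) eq = contradiction eq (All-at x≢ j<n)
  at-injective {xs = _ ∷ _} (x≢ ∷ u) {suc i} {zero}  (s≤s i<n) _         eq = contradiction (sym eq) (All-at x≢ i<n)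
  at-injective {xs = _ ∷ _} (x≢ ∷ u) {suc i} {suc j} (s≤s i<n) (s≤s j<n) eq = cong suc (at-injective u i<n j<n eq)

map-unique : ∀ {A : Set} {m} {f : ℕ → A} {is} → InjectiveBelow m f → All (_< m) is → Unique is → Unique (map f is)
map-unique f-inj []           []         = []
map-unique {f = f} f-inj (i<m ∷ is<m) (i∉is ∷ u) = fresh is<m i∉is ∷ map-unique f-inj is<m u
  where
  fresh : ∀ {js} → All (_< _) js → All (_ ≢_) js → All (f _ ≢_) (map f js)
  fresh []             []           = []
  fresh (j<m ∷ js<m) (i≢j ∷ i∉js) = (i≢j ∘ f-inj i<m j<m) ∷ fresh js<m i∉js

-- Pigeonhole: if every element had a preimage below `q`, choosing one for each would inject `Fin k`
-- into `Fin q`. This supplies both unnamed vertices and unnamed hues.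
∃-fresh : ∀ {k q} → q < k → (f : ℕ → Fin k) → ∃[ a ] ∀ {i} → i < q → f i ≢ a
∃-fresh {k} {q} q<k f with Fin.any? (λ a → ¬? (anyUpTo? (λ i → f i Fin.≟ a) q))
... | yes (a , a∉) = a , λ i<q eq → a∉ (_ , i<q , eq)
... | no  none     = contradiction (Fin.injective⇒≤ {f = index} index-injective) (<⇒≱ q<k)
  where
  preimage : ∀ a → ∃[ i ] i < q × f i ≡ a
  preimage a with anyUpTo? (λ i → f i Fin.≟ a) q
  ... | yes p = p
  ... | no ¬p = contradiction (a , ¬p) none

  index : Fin k → Fin q
  index a = fromℕ< (proj₁ (proj₂ (preimage a)))

  index-injective : ∀ {a b} → index a ≡ index b → a ≡ b
  index-injective {a} {b} eq =
    trans (sym (proj₂ (proj₂ (preimage a))))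
      (trans (cong f (Fin.fromℕ<-injective _ _ _ _ eq)) (proj₂ (proj₂ (preimage b))))

-- Refuting partial colourings by exhaustive search

-- Vertices and hues are named by 0, 1, 2, … in order of appearance; (i , j , c)
-- records that ij has hue c, and each known edge is recorded in both directions.
Arc : Set
Arc = ℕ × ℕ × ℕ

link : ℕ → ℕ → ℕ → List Arc → List Arc
link i j c as = (i , j , c) ∷ (j , i , c) ∷ as

differs : ℕ → ℕ → Bool
differs x y = not (x ≡ᵇ y)

module _ (as : List Arc) where

  joined : ℕ → ℕ → ℕ → Bool
  joined i j c = any (λ (a , b , d) → (a ≡ᵇ i) ∧ (b ≡ᵇ j) ∧ (d ≡ᵇ c)) as

  coloured : ℕ → ℕ → Bool
  coloured i j = any (λ (a , b , _) → (a ≡ᵇ i) ∧ (b ≡ᵇ j)) as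

  -- Here `a` has degree 3, `b` and `b′` complete the triangle and `b″` is pendent. Arcs join
  -- distinct vertices, so `joined b b′ d` also separates `b` from `b′`.
  pawAt : Arc → Bool
  pawAt (a , b , d) =
    any (λ (a′ , b′ , d′) → (a′ ≡ᵇ a) ∧ (d′ ≡ᵇ d) ∧ joined b b′ d ∧
      any (λ (a″ , b″ , d″) → (a″ ≡ᵇ a) ∧ (d″ ≡ᵇ d) ∧ differs b″ b ∧ differs b″ b′) as) as

  -- `is` is the path so far, read backwards from its end `i`, and `cs` holds its hues in the same
  -- order; `r` more edges are to be added.
  extends : ℕ → ℕ → List ℕ → List ℕ → Bool
  extends zero    i is cs = true
  extends (suc r) i is cs =
    any (λ (a , b , d) → (a ≡ᵇ i) ∧ all (differs b) is ∧ all (differs d) cs ∧ extends r b (b ∷ is) (d ∷ cs)) as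

  -- A monochromatic paw, or a rainbow path with r + 2 vertices.
  closed : ℕ → Bool
  closed r = any (λ (a , b , d) → pawAt (a , b , d) ∨ extends r b (b ∷ a ∷ []) (d ∷ [])) as

allBelow : (ℕ → Bool) → ℕ → Bool
allBelow f zero    = true
allBelow f (suc n) = f n ∧ allBelow f n

data Move : Set where
  vertex fresh : Move
  edge         : ℕ → ℕ → Move

-- The host graph has at least N vertices and at least K hues.  As long as fewer
-- than K hues are named, some edge has an unnamed hue; the move fresh branches
-- over how many of its ends are named already.  The move edge branches over the
-- hue of an edge between named vertices.
module Search (r N K : ℕ) where

  refuted     : List Move → ℕ → ℕ → List Arc → Bool
  refutedNext : List Move → ℕ → ℕ → List Arc → Bool

  refutedNext p m q as = closed as r ∨ refuted p m q as

  refuted []             m q as = false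
  refuted (vertex ∷ p)   m q as = if m <ᵇ N then refuted p (suc m) q as else refuted p m q as
  refuted (fresh ∷ p)    m q as =
    (q <ᵇ K) ∧
    -- An edge that is already coloured has a named hue, so it cannot bear the fresh one.
    allBelow (λ j → allBelow (λ i → coloured as i j ∨ refutedNext p m (suc q) (link i j q as)) j) m ∧
    allBelow (λ i → refutedNext p (suc m) (suc q) (link i m q as)) m ∧
    refutedNext p (suc (suc m)) (suc q) (link m (suc m) q as)
  refuted (edge i j ∷ p) m q as =
    if (i <ᵇ j) ∧ (j <ᵇ m) ∧ not (coloured as i j)
    then allBelow (λ c → refutedNext p m q (link i j c as)) q ∧ refutedNext p m (suc q) (link i j q as)
    else refuted p m q as

-- The search skips edges that are coloured already or have an unnamed end, so one list serves all
-- branches.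
allEdges : ℕ → List Move
allEdges n = concatMap (λ j → map (λ i → edge i j) (upTo j)) (upTo n)

path₄ : List Arc
path₄ = link 0 1 0 (link 1 2 1 (link 2 3 2 []))

-- Edges of three hues span at least three vertices, so in `plan₁` two moves `vertex` suffice to
-- reach five. In `plan₃` the first sweep leaves open only branches with four named hues and all
-- named edges coloured; the edge of a fifth hue must then reach a new vertex.
plan₁ plan₂ plan₃ : List Move
plan₁ = fresh ∷ fresh ∷ fresh ∷ vertex ∷ vertex ∷ allEdges 6
plan₂ = fresh ∷ vertex ∷ vertex ∷ allEdges 6
plan₃ = fresh ∷ vertex ∷ allEdges 6 ++ (fresh ∷ allEdges 6)

search₁ : Search.refuted 2 5 3 plan₁ 0 0 [] ≡ true
search₁ = refl

search₂ : Search.refuted 3 6 4 plan₂ 4 3 path₄ ≡ true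
search₂ = refl

search₃ : Search.refuted 3 5 5 plan₃ 4 3 path₄ ≡ true
search₃ = refl

-- Rainbow paths, paws and the soundness of the search

module Hues {n k : ℕ} (χ : Fin n → Fin n → Fin k) where

  hues : List (Fin n) → List (Fin k)
  hues []           = []
  hues (u ∷ [])     = []
  hues (u ∷ v ∷ vs) = χ u v ∷ hues (v ∷ vs)

  RainbowPath : List (Fin n) → Set
  RainbowPath vs = Unique vs × Unique (hues vs)

  -- a is the vertex of degree 3 and d the vertex of degree 1.
  record Paw (a b c d : Fin n) : Set where
    constructor paw
    field
      distinct : Unique (a ∷ b ∷ c ∷ d ∷ [])
      ab≡ac    : χ a b ≡ χ a c
      ab≡ad    : χ a b ≡ χ a d
      ab≡bc    : χ a b ≡ χ b c

module Soundness {n k : ℕ} (χ : Fin n → Fin n → Fin k) (χ-sym : ∀ u v → χ u v ≡ χ v u)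
                 (χ-exact : ∀ a → ∃₂ λ u v → u ≢ v × χ u v ≡ a) where

  open Hues χ

  -- A model interprets the `m` vertex names and `q` hue names faithfully in the actual colouring;
  -- soundness says that a refuted state has no model.
  record Model (m q : ℕ) (as : List Arc) : Set where
    field
      ρ     : ℕ → Fin n
      ν     : ℕ → Fin k
      ρ-inj : InjectiveBelow m ρ
      ν-inj : InjectiveBelow q ν

    Holds : Arc → Set
    Holds (i , j , c) = i < m × j < m × i ≢ j × c < q × χ (ρ i) (ρ j) ≡ ν c

    field
      holds : All Holds as

    witness : ∀ {p : Arc → Bool} → T (any p as) →
              ∃[ i ] ∃[ j ] ∃[ c ] Holds (i , j , c) × T (p (i , j , c))
    witness {p} t = _ , _ , _ , All.lookupAny holds (any⁻ p as t)

  addVertex : ∀ {m q as} (M : Model m q as) (v : Fin n) → (∀ {i} → i < m → Model.ρ M i ≢ v) → Model (suc m) q as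
  addVertex {m} M v v∉ = record
    { ρ     = ρ [ m ↦ v ]
    ; ν     = ν
    ; ρ-inj = update-injective ρ-inj v∉
    ; ν-inj = ν-inj
    ; holds = All.map (λ (i<m , j<m , i≢j , c<q , eq) → m<n⇒m<1+n i<m , m<n⇒m<1+n j<m , i≢j , c<q ,
                trans (cong₂ χ (update-< ρ i<m) (update-< ρ j<m)) eq) holds
    }
    where open Model M

  addHue : ∀ {m q as} (M : Model m q as) (a : Fin k) → (∀ {c} → c < q → Model.ν M c ≢ a) → Model m (suc q) as
  addHue {q = q} M a a∉ = record
    { ρ     = ρ
    ; ν     = ν [ q ↦ a ]
    ; ρ-inj = ρ-inj
    ; ν-inj = update-injective ν-inj a∉
    ; holds = All.map (λ (i<m , j<m , i≢j , c<q , eq) → i<m , j<m , i≢j , m<n⇒m<1+n c<q ,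
                trans eq (sym (update-< ν c<q))) holds
    }
    where open Model M

  addLink : ∀ {m q as i j c} (M : Model m q as) → Model.Holds M (i , j , c) → Model m q (link i j c as)
  addLink M h@(i<m , j<m , i≢j , c<q , eq) = record
    { ρ     = ρ
    ; ν     = ν
    ; ρ-inj = ρ-inj
    ; ν-inj = ν-inj
    ; holds = h ∷ (j<m , i<m , i≢j ∘ sym , c<q , trans (χ-sym _ _) eq) ∷ holds
    }
    where open Model M

  ∧⁻ : ∀ {x y} → T (x ∧ y) → T x × T y
  ∧⁻ = Equivalence.to T-∧

  ∨⁻ : ∀ {x y} → T (x ∨ y) → T x ⊎ T y
  ∨⁻ = Equivalence.to T-∨

  differs⇒≢ : ∀ x y → T (differs x y) → x ≢ y
  differs⇒≢ x y t refl with x ≡ᵇ x in eq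
  ... | false = subst T eq (≡⇒≡ᵇ x x refl)

  allDiffer⇒≢ : ∀ x ys → T (all (differs x) ys) → All (x ≢_) ys
  allDiffer⇒≢ x ys t = All.map (differs⇒≢ x _) (all⁺ (differs x) ys t)

  allBelow⇒∀ : ∀ f m {i} → T (allBelow f m) → i < m → T (f i)
  allBelow⇒∀ f (suc m) t i<1+m with m<1+n⇒m<n∨m≡n i<1+m
  ... | inj₁ i<m  = allBelow⇒∀ f m (proj₂ (∧⁻ t)) i<m
  ... | inj₂ refl = proj₁ (∧⁻ t)

  module _ (r : ℕ) (noPath : ∀ vs → length vs ≡ 2 + r → ¬ RainbowPath vs)
           (noPaw : ∀ {a b c d} → ¬ Paw a b c d) where

    -- Invariant: the path named by `i ∷ is` has the hues named by `cs`, and `s` further vertices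
    -- bring it to `2 + r`. At `s = 0` it is a forbidden rainbow path.
    extends⇒⊥ : ∀ {m q as} (M : Model m q as) (let open Model M) s {i is cs} →
                All (_< m) (i ∷ is) → Unique (i ∷ is) → All (_< q) cs → Unique cs →
                hues (map ρ (i ∷ is)) ≡ map ν cs → s + length (i ∷ is) ≡ 2 + r →
                T (extends as s i (i ∷ is) cs) → ⊥
    extends⇒⊥ M zero {i} {is} is<m u cs<q w eq len t =
      noPath (map ρ (i ∷ is)) (trans (length-map ρ (i ∷ is)) len)
        (map-unique ρ-inj is<m u , subst Unique (sym eq) (map-unique ν-inj cs<q w))
      where open Model M
    extends⇒⊥ M (suc s) {i} {is} {cs} is<m u cs<q w eq len t
      with a , b , d , (_ , b<m , _ , d<q , χ≡) , t₁ ← Model.witness M t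
      with a≡i , t₂ ← ∧⁻ t₁
      with b∉ , t₃ ← ∧⁻ {all (differs b) (i ∷ is)} t₂
      with d∉ , t₄ ← ∧⁻ t₃
      with refl ← ≡ᵇ⇒≡ a i a≡i =
      extends⇒⊥ M s (b<m ∷ is<m) (allDiffer⇒≢ b (i ∷ is) b∉ ∷ u) (d<q ∷ cs<q) (allDiffer⇒≢ d cs d∉ ∷ w)
        (cong₂ _∷_ (trans (χ-sym _ _) χ≡) eq) (trans (+-suc s _) len) t₄

    pawAt⇒⊥ : ∀ {m q as} (M : Model m q as) {i j c} → Model.Holds M (i , j , c) → T (pawAt as (i , j , c)) → ⊥
    pawAt⇒⊥ M {i} {j} {c} (i<m , j<m , i≢j , _ , ij) t
      with i₁ , j₁ , c₁ , (_ , j₁<m , i≢j₁ , _ , ij₁) , t₁ ← Model.witness M t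
      with p₁ , t₂ ← ∧⁻ t₁
      with q₁ , t₃ ← ∧⁻ t₂
      with base , pendant ← ∧⁻ t₃
      with j₂ , j₃ , c₃ , (_ , _ , j≢j₁ , _ , jj₁) , s₁ ← Model.witness M base
      with p₂ , s₂ ← ∧⁻ s₁
      with p₃ , q₂ ← ∧⁻ s₂
      with i₄ , j₄ , c₄ , (_ , j₄<m , i≢j₄ , _ , ij₄) , r₁ ← Model.witness M pendant
      with p₄ , r₂ ← ∧⁻ r₁
      with q₄ , r₃ ← ∧⁻ r₂
      with j₄≢j , j₄≢j₁ ← ∧⁻ {differs j₄ j} r₃
      with refl ← ≡ᵇ⇒≡ i₁ i p₁
         | refl ← ≡ᵇ⇒≡ c₁ c q₁
         | refl ← ≡ᵇ⇒≡ j₂ j p₂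
         | refl ← ≡ᵇ⇒≡ j₃ j₁ p₃
         | refl ← ≡ᵇ⇒≡ c₃ c q₂
         | refl ← ≡ᵇ⇒≡ i₄ i p₄
         | refl ← ≡ᵇ⇒≡ c₄ c q₄ =
      noPaw (paw (map-unique ρ-inj (i<m ∷ j<m ∷ j₁<m ∷ j₄<m ∷ [])
          ((i≢j ∷ i≢j₁ ∷ i≢j₄ ∷ []) ∷ (j≢j₁ ∷ differs⇒≢ j₄ j j₄≢j ∘ sym ∷ []) ∷ (differs⇒≢ j₄ j₁ j₄≢j₁ ∘ sym ∷ []) ∷ [] ∷ []))
        (trans ij (sym ij₁)) (trans ij (sym ij₄)) (trans ij (sym jj₁)))
      where open Model M

    closed⇒⊥ : ∀ {m q as} → Model m q as → T (closed as r) → ⊥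
    closed⇒⊥ M t
      with i , j , c , h@(i<m , j<m , i≢j , c<q , ij) , t₁ ← Model.witness M t
      with ∨⁻ t₁
    ... | inj₁ isPaw = pawAt⇒⊥ M h isPaw
    ... | inj₂ ext   = extends⇒⊥ M r (j<m ∷ i<m ∷ []) ((i≢j ∘ sym ∷ []) ∷ [] ∷ []) (c<q ∷ []) ([] ∷ [])
                         (cong (_∷ []) (trans (χ-sym _ _) ij)) (+-comm r 2) ext

    module _ {N K : ℕ} (N≤n : N ≤ n) (K≤k : K ≤ k) where

      open Search r N K

      -- Induction on the plan: the branches of a move are exhaustive, so a model extends to a model
      -- of one of them, and that branch is closed or refuted later.
      refuted⇒⊥     : ∀ p {m q as} → T (refuted p m q as) → Model m q as → ⊥
      refutedNext⇒⊥ : ∀ p {m q as} → T (refutedNext p m q as) → Model m q as → ⊥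

      refutedNext⇒⊥ p t M = [ closed⇒⊥ M , (λ t′ → refuted⇒⊥ p t′ M) ]′ (∨⁻ t)

      refuted⇒⊥ (vertex ∷ p) {m} t M with m <ᵇ N in eq
      ... | true  = let v , v∉ = ∃-fresh (<-≤-trans (<ᵇ⇒< m N (subst T (sym eq) _)) N≤n) (Model.ρ M)
                    in refuted⇒⊥ p t (addVertex M v v∉)
      ... | false = refuted⇒⊥ p t M
      refuted⇒⊥ (fresh ∷ p) {m} {q} {as} t M
        with q<K , t₁ ← ∧⁻ t
        with inside , t₂ ← ∧⁻ t₁
        with half , outside ← ∧⁻ t₂
        -- Exactness provides an edge `u v` in a hue `a` that has no name yet; the cases are which
        -- of its ends are named.
        with a , a∉ ← ∃-fresh (<-≤-trans (<ᵇ⇒< q K q<K) K≤k) (Model.ν M)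
        with u , v , u≢v , uv≡a ← χ-exact a = cases (known? u) (known? v)
        where
        open Model M

        known? : ∀ x → Dec (∃[ i ] i < m × ρ i ≡ x)
        known? x = anyUpTo? (λ i → ρ i Fin.≟ x) m

        M₁ : Model m (suc q) as
        M₁ = addHue M a a∉

        newHue : a ≡ (ν [ q ↦ a ]) q
        newHue = sym (update-≡ ν q)

        insideCase : ∀ {i j} → i < j → j < m → χ (ρ i) (ρ j) ≡ a → ⊥
        insideCase {i} {j} i<j j<m ij≡a with ∨⁻ (allBelow⇒∀ _ j (allBelow⇒∀ _ m inside j<m) i<j)
        ... | inj₂ t₄ = refutedNext⇒⊥ p t₄
                          (addLink M₁ (<-trans i<j j<m , j<m , <⇒≢ i<j , ≤-refl , trans ij≡a newHue))
        ... | inj₁ t₄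
          with i′ , j′ , c , (_ , _ , _ , c<q , eq) , t₅ ← witness t₄
          with p₁ , p₂ ← ∧⁻ t₅
          with refl ← ≡ᵇ⇒≡ i′ i p₁ | refl ← ≡ᵇ⇒≡ j′ j p₂ = a∉ c<q (trans (sym eq) ij≡a)

        halfCase : ∀ {i w} → i < m → (∀ {i} → i < m → ρ i ≢ w) → χ (ρ i) w ≡ a → ⊥
        halfCase i<m w∉ iw≡a = refutedNext⇒⊥ p (allBelow⇒∀ _ m half i<m)
          (addLink (addVertex M₁ _ w∉) (m<n⇒m<1+n i<m , ≤-refl , <⇒≢ i<m , ≤-refl ,
            trans (cong₂ χ (update-< ρ i<m) (update-≡ ρ m)) (trans iw≡a newHue)))

        outsideCase : (∀ {i} → i < m → ρ i ≢ u) → (∀ {i} → i < m → ρ i ≢ v) → ⊥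
        outsideCase u∉ v∉ = refutedNext⇒⊥ p outside
          (addLink (addVertex (addVertex M₁ u u∉) v v∉′)
            (m<n⇒m<1+n ≤-refl , ≤-refl , <⇒≢ ≤-refl , ≤-refl ,
              trans (cong₂ χ (trans (update-< (ρ [ m ↦ u ]) ≤-refl) (update-≡ ρ m)) (update-≡ (ρ [ m ↦ u ]) (suc m))) (trans uv≡a newHue)))
          where
          v∉′ : ∀ {i} → i < suc m → (ρ [ m ↦ u ]) i ≢ v
          v∉′ i<1+m eq with m<1+n⇒m<n∨m≡n i<1+m
          ... | inj₁ i<m  = v∉ i<m (trans (sym (update-< ρ i<m)) eq)
          ... | inj₂ refl = u≢v (trans (sym (update-≡ ρ m)) eq)

        cases : Dec (∃[ i ] i < m × ρ i ≡ u) → Dec (∃[ j ] j < m × ρ j ≡ v) → ⊥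
        cases (yes (i , i<m , refl)) (yes (j , j<m , refl)) with <-cmp i j
        ... | tri< i<j _ _    = insideCase i<j j<m uv≡a
        ... | tri≈ _ refl _   = u≢v refl
        ... | tri> _ _ j<i    = insideCase j<i i<m (trans (χ-sym _ _) uv≡a)
        cases (yes (i , i<m , refl)) (no v∉) = halfCase i<m (λ j<m eq → v∉ (_ , j<m , eq)) uv≡a
        cases (no u∉) (yes (j , j<m , refl)) = halfCase j<m (λ i<m eq → u∉ (_ , i<m , eq)) (trans (χ-sym _ _) uv≡a)
        cases (no u∉) (no v∉) = outsideCase (λ i<m eq → u∉ (_ , i<m , eq)) (λ j<m eq → v∉ (_ , j<m , eq))
      refuted⇒⊥ (edge i j ∷ p) {m} {q} {as} t M with (i <ᵇ j) ∧ (j <ᵇ m) ∧ not (coloured as i j) in eq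
      ... | false = refuted⇒⊥ p t M
      ... | true
        with named , new ← ∧⁻ t
        with i<ᵇj , g₁ ← ∧⁻ {i <ᵇ j} (Equivalence.from T-≡ eq)
        with j<ᵇm , _ ← ∧⁻ {j <ᵇ m} g₁
        with i<j ← <ᵇ⇒< i j i<ᵇj | j<m ← <ᵇ⇒< j m j<ᵇm
        with anyUpTo? (λ c → Model.ν M c Fin.≟ χ (Model.ρ M i) (Model.ρ M j)) q
      ... | yes (c , c<q , eq′) = refutedNext⇒⊥ p (allBelow⇒∀ _ q named c<q)
                                    (addLink M (<-trans i<j j<m , j<m , <⇒≢ i<j , c<q , sym eq′))
      ... | no unnamed = refutedNext⇒⊥ p new
                           (addLink (addHue M _ (λ c<q eq′ → unnamed (_ , c<q , eq′)))
                             (<-trans i<j j<m , j<m , <⇒≢ i<j , ≤-refl , sym (update-≡ (Model.ν M) q)))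

      search⇒⊥ : ∀ p {m q as} → Model m q as → Search.refuted r N K p m q as ≡ true → ⊥
      search⇒⊥ p M eq = refuted⇒⊥ p (Equivalence.from T-≡ eq) M

-- Forced configurations with at least four colours

module Forcing {n k : ℕ} (χ : Fin n → Fin n → Fin k) (χ-sym : ∀ u v → χ u v ≡ χ v u)
               (χ-exact : ∀ a → ∃₂ λ u v → u ≢ v × χ u v ≡ a) where

  open Hues χ
  open Soundness χ χ-sym χ-exact

  emptyModel : 5 ≤ n → 3 ≤ k → Model 0 0 []
  emptyModel 5≤n 3≤k = record
    -- Nothing is named yet, so the values are junk; the size bounds show that some vertex and some
    -- hue exist.
    { ρ     = λ _ → fromℕ< (≤-trans (s≤s z≤n) 5≤n)
    ; ν     = λ _ → fromℕ< (≤-trans (s≤s z≤n) 3≤k)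
    ; ρ-inj = λ ()
    ; ν-inj = λ ()
    ; holds = []
    }

  pathModel : ∀ {a b c d} → RainbowPath (a ∷ b ∷ c ∷ d ∷ []) → Model 4 3 path₄
  pathModel {a} {b} {c} {d} (distinct , rainbow) = record
    { ρ     = at a (a ∷ b ∷ c ∷ d ∷ [])
    ; ν     = at (χ a b) (hues (a ∷ b ∷ c ∷ d ∷ []))
    ; ρ-inj = at-injective distinct
    ; ν-inj = at-injective rainbow
    ; holds = (<ᵇ⇒< 0 4 _ , <ᵇ⇒< 1 4 _ , (λ ()) , <ᵇ⇒< 0 3 _ , refl) ∷ (<ᵇ⇒< 1 4 _ , <ᵇ⇒< 0 4 _ , (λ ()) , <ᵇ⇒< 0 3 _ , χ-sym b a)
            ∷ (<ᵇ⇒< 1 4 _ , <ᵇ⇒< 2 4 _ , (λ ()) , <ᵇ⇒< 1 3 _ , refl) ∷ (<ᵇ⇒< 2 4 _ , <ᵇ⇒< 1 4 _ , (λ ()) , <ᵇ⇒< 1 3 _ , χ-sym c b)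
            ∷ (<ᵇ⇒< 2 4 _ , <ᵇ⇒< 3 4 _ , (λ ()) , <ᵇ⇒< 2 3 _ , refl) ∷ (<ᵇ⇒< 3 4 _ , <ᵇ⇒< 2 4 _ , (λ ()) , <ᵇ⇒< 2 3 _ , χ-sym d c) ∷ []
    }

  -- The first search excludes the absence of both rainbow P₄ and paw. That P₄ is absent is in turn
  -- derived by starting a second search from a supposed rainbow P₄.
  rainbowP₅-or-paw : (6 ≤ n × 4 ≤ k) ⊎ (5 ≤ n × 5 ≤ k) →
                     (∀ vs → length vs ≡ 5 → ¬ RainbowPath vs) → (∀ {a b c d} → ¬ Paw a b c d) → ⊥
  rainbowP₅-or-paw large noP₅ noPaw =
    search⇒⊥ 2 noP₄ noPaw 5≤n 3≤k plan₁ (emptyModel 5≤n 3≤k) search₁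
    where
    5≤n : 5 ≤ n
    5≤n = [ (λ (6≤n , _) → <⇒≤ 6≤n) , proj₁ ]′ large

    3≤k : 3 ≤ k
    3≤k = [ (λ (_ , 4≤k) → <⇒≤ 4≤k) , (λ (_ , 5≤k) → ≤-trans (≤ᵇ⇒≤ 3 5 _) 5≤k) ]′ large

    noP₄ : ∀ vs → length vs ≡ 4 → ¬ RainbowPath vs
    noP₄ (a ∷ b ∷ c ∷ d ∷ []) refl path =
      [ (λ (6≤n , 4≤k) → search⇒⊥ 3 noP₅ noPaw 6≤n 4≤k plan₂ (pathModel path) search₂)
      , (λ (5≤n , 5≤k) → search⇒⊥ 3 noP₅ noPaw 5≤n 5≤k plan₃ (pathModel path) search₃) ]′ large

-- The Ramsey numbers of the triangle and of the paw

-- More vertices than the bound force the graph in r colours, so that the Ramsey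
-- number itself is at most one larger.
triangleBound pawBound : ℕ → ℕ
triangleBound zero    = 1
triangleBound (suc r) = 1 + suc r * triangleBound r
pawBound zero    = 1
pawBound (suc r) = triangleBound (suc r) ⊔ (3 + r * pawBound r)

length-filter-complement : ∀ {A : Set} {P : A → Set} (P? : ∀ x → Dec (P x)) xs →
                           length (filter P? xs) + length (filter (¬? ∘ P?) xs) ≡ length xs
length-filter-complement P? []       = refl
length-filter-complement P? (x ∷ xs) with P? x
... | yes _ = cong suc (length-filter-complement P? xs)
... | no  _ = trans (+-suc _ _) (cong suc (length-filter-complement P? xs))

_without_ : ∀ {n} → List (Fin n) → Fin n → List (Fin n)
xs without x = filter (λ y → ¬? (y Fin.≟ x)) xs

module _ {n : ℕ} where

  ∈-without⁺ : ∀ {x y} {xs : List (Fin n)} → y ∈ xs → y ≢ x → y ∈ xs without x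
  ∈-without⁺ = ∈-filter⁺ _

  ∈-without⁻ : ∀ {x y} (xs : List (Fin n)) → y ∈ xs without x → y ∈ xs × y ≢ x
  ∈-without⁻ xs = ∈-filter⁻ _ {xs = xs}

  without-unique : ∀ {x} {xs : List (Fin n)} → Unique xs → Unique (xs without x)
  without-unique = Unique.filter⁺ _

  length-without-< : ∀ {x r} {xs : List (Fin n)} → x ∈ xs → length xs ≤ suc r → length (xs without x) ≤ r
  length-without-< {xs = xs} x∈xs len =
    ≤-pred (≤-trans (filter-notAll _ xs (Any.map (λ x≡y y≢x → y≢x (sym x≡y)) x∈xs)) len)

  length-without-> : ∀ {x r} {xs : List (Fin n)} → Unique xs → suc r < length xs → r < length (xs without x)
  length-without-> u len = ≤-pred (≤-trans len (bound u))
    where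
    bound : ∀ {x} {xs : List (Fin n)} → Unique xs → length xs ≤ suc (length (xs without x))
    bound [] = z≤n
    bound {x} {y ∷ ys} (y∉ys ∷ u) with y Fin.≟ x
    ... | yes refl = s≤s (≤-reflexive (sym (cong length (filter-all _ (All.map (λ y≢z → y≢z ∘ sym) y∉ys)))))
    ... | no  _    = s≤s (bound u)

  ∃-member : ∀ {xs : List (Fin n)} → 0 < length xs → ∃[ x ] x ∈ xs
  ∃-member {x ∷ _} _ = x , here refl

  member⇒nonempty : ∀ {x} {xs : List (Fin n)} → x ∈ xs → 0 < length xs
  member⇒nonempty {xs = _ ∷ _} _ = s≤s z≤n

module Ramsey {n k : ℕ} (χ : Fin n → Fin n → Fin k) (χ-sym : ∀ u v → χ u v ≡ χ v u) where

  open Hues χ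

  -- Pigeonhole, by removing one hue at a time: a class of size at most `r` leaves more than
  -- `length gs * r` elements for the remaining hues `gs`.
  majority : ∀ r gs xs (f : Fin n → Fin k) → (∀ {x} → x ∈ xs → f x ∈ gs) → Unique xs → length gs * r < length xs →
             ∃[ g ] ∃[ ys ] g ∈ gs × Unique ys × r < length ys × (∀ {y} → y ∈ ys → y ∈ xs × f y ≡ g)
  majority r []       (x ∷ xs) f f∈ u len with () ← f∈ (here refl)
  majority r (g ∷ gs) xs       f f∈ u len with r <? length (filter (λ x → f x Fin.≟ g) xs)
  ... | yes big = g , _ , here refl , Unique.filter⁺ _ u , big , ∈-filter⁻ _ {xs = xs}
  ... | no small =
    let h , ys , h∈ , uys , r<ys , inYs = majority r gs rest f rest∈ (Unique.filter⁺ _ u) len′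
    in h , ys , there h∈ , uys , r<ys , λ y∈ → proj₁ (inRest (proj₁ (inYs y∈))) , proj₂ (inYs y∈)
    where
    rest = filter (λ x → ¬? (f x Fin.≟ g)) xs

    inRest : ∀ {x} → x ∈ rest → x ∈ xs × f x ≢ g
    inRest = ∈-filter⁻ _ {xs = xs}

    rest∈ : ∀ {x} → x ∈ rest → f x ∈ gs
    rest∈ x∈ with inRest x∈
    ... | x∈xs , fx≢g with f∈ x∈xs
    ...   | here fx≡g = contradiction fx≡g fx≢g
    ...   | there fx∈ = fx∈

    len′ : length gs * r < length rest
    len′ = +-cancelˡ-< r _ _ (<-≤-trans len (≤-trans
      (≤-reflexive (sym (length-filter-complement (λ x → f x Fin.≟ g) xs)))
      (+-monoˡ-≤ (length rest) (≮⇒≥ small))))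

  Palette : List (Fin k) → List (Fin n) → Set
  Palette gs xs = ∀ {x y} → x ∈ xs → y ∈ xs → x ≢ y → χ x y ∈ gs

  record Triangle (xs : List (Fin n)) : Set where
    constructor triangle
    field
      {x y z}          : Fin n
      x∈ : x ∈ xs
      y∈ : y ∈ xs
      z∈ : z ∈ xs
      x≢y : x ≢ y
      x≢z : x ≢ z
      y≢z : y ≢ z
      xy≡xz : χ x y ≡ χ x z
      xy≡yz : χ x y ≡ χ y z

  -- Let `ys` be the vertices that `x` sees in a most useful hue `g`. An edge of hue `g` inside `ys`
  -- closes a triangle at `x`; otherwise `g` leaves the palette of `ys` and induction applies.
  ∃-triangle : ∀ r gs xs → length gs ≤ r → triangleBound r < length xs → Unique xs → Palette gs xs → Triangle xs
  ∃-triangle zero    []  (x ∷ y ∷ xs) _   len ((x≢y ∷ _) ∷ _) pal with () ← pal (here refl) (there (here refl)) x≢y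
  ∃-triangle zero    []  (x ∷ [])     _   (s≤s ()) _ _
  ∃-triangle (suc r) gs (x ∷ xs) gs≤ (s≤s len) (x∉ ∷ u) pal
    with g , ys , g∈ , uys , r<ys , inYs ← majority (triangleBound r) gs xs (χ x)
           (λ y∈ → pal (here refl) (there y∈) (All.lookup x∉ y∈)) u
           (≤-<-trans (*-monoˡ-≤ (triangleBound r) gs≤) len)
    with Any.any? (λ y → Any.any? (λ z → ¬? (y Fin.≟ z) ×-dec (χ y z Fin.≟ g)) ys) ys
  ... | yes p
    with y , y∈ , q ← find p
    with z , z∈ , y≢z , yz≡g ← find q
    with y∈xs , xy≡g ← inYs y∈ | z∈xs , xz≡g ← inYs z∈ =
    triangle (here refl) (there y∈xs) (there z∈xs) (All.lookup x∉ y∈xs) (All.lookup x∉ z∈xs) y≢z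
      (trans xy≡g (sym xz≡g)) (trans xy≡g (sym yz≡g))
  ... | no none
    with triangle x∈ y∈ z∈ x≢y x≢z y≢z e e′ ← ∃-triangle r (gs without g) ys (length-without-< g∈ gs≤) r<ys uys
           (λ y∈ z∈ y≢z → ∈-without⁺ (pal (there (proj₁ (inYs y∈))) (there (proj₁ (inYs z∈))) y≢z)
             (λ yz≡g → none (lose y∈ (lose z∈ (y≢z , yz≡g))))) =
    triangle (up x∈) (up y∈) (up z∈) x≢y x≢z y≢z e e′
    where
    up : ∀ {w} → w ∈ ys → w ∈ x ∷ xs
    up w∈ = there (proj₁ (inYs w∈))

  -- In a paw-free colouring, the hue g of a monochromatic triangle xyz is absent
  -- between x and the other vertices, and the most frequent hue there, say h, is
  -- absent among the vertices that x sees in hue h.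
  pawFree⇒⊥ : (∀ {a b c d} → ¬ Paw a b c d) → ∀ r gs xs → length gs ≤ r → pawBound r < length xs → Unique xs →
              Palette gs xs → ⊥
  pawFree⇒⊥ noPaw zero    [] (x ∷ [])     _   (s≤s ()) _               _
  pawFree⇒⊥ noPaw zero    [] (x ∷ y ∷ xs) _   len      ((x≢y ∷ _) ∷ _) pal with () ← pal (here refl) (there (here refl)) x≢y
  pawFree⇒⊥ noPaw (suc r) gs xs gs≤ len u pal
    with triangle {x} {y} {z} x∈ y∈ z∈ x≢y x≢z y≢z xy≡xz xy≡yz
           ← ∃-triangle (suc r) gs xs gs≤ (≤-<-trans (m≤m⊔n (triangleBound (suc r)) (3 + r * pawBound r)) len) u pal = absurd
    where
    rest = ((xs without x) without y) without z

    inRest : ∀ {w} → w ∈ rest → w ∈ xs × w ≢ x × w ≢ y × w ≢ z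
    inRest w∈ =
      let w∈₁ , w≢z = ∈-without⁻ ((xs without x) without y) w∈
          w∈₂ , w≢y = ∈-without⁻ (xs without x) w∈₁
          w∈₃ , w≢x = ∈-without⁻ xs w∈₂
      in w∈₃ , w≢x , w≢y , w≢z

    otherHue : ∀ {w} → w ∈ rest → χ x w ∈ gs without χ x y
    otherHue w∈ =
      let w∈xs , w≢x , w≢y , w≢z = inRest w∈
      in ∈-without⁺ (pal x∈ w∈xs (w≢x ∘ sym)) λ xw≡xy →
           noPaw (paw ((x≢y ∷ x≢z ∷ w≢x ∘ sym ∷ []) ∷ (y≢z ∷ w≢y ∘ sym ∷ []) ∷ (w≢z ∘ sym ∷ []) ∷ [] ∷ [])
             xy≡xz (sym xw≡xy) xy≡yz)

    gs′≤ : length (gs without χ x y) ≤ r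
    gs′≤ = length-without-< (pal x∈ y∈ x≢y) gs≤

    rest-large : length (gs without χ x y) * pawBound r < length rest
    rest-large = ≤-<-trans (*-monoˡ-≤ (pawBound r) gs′≤)
      (length-without-> (without-unique (without-unique u))
        (length-without-> (without-unique u)
          (length-without-> u (≤-<-trans (m≤n⊔m (triangleBound (suc r)) _) len))))

    absurd : ⊥
    absurd
      with g , ws , g∈ , uws , r<ws , inWs ← majority (pawBound r) (gs without χ x y) rest (χ x) otherHue
             (without-unique (without-unique (without-unique u))) rest-large =
      pawFree⇒⊥ noPaw r (gs without g) ws (length-without-< (proj₁ (∈-without⁻ gs g∈)) gs≤) r<ws uws pal′
      where
      -- A third vertex `t` of `ws` has to serve as the pendent vertex at `x`. As `g` lies in the
      -- reduced palette, `s` is positive, and then `pawBound s` is at least 3.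
      two<ws : ∀ {s} → pawBound s < length ws → length (gs without χ x y) ≤ s → 2 < length ws
      two<ws {suc s} s<ws _ = <-trans (≤-trans (m≤m+n 3 _) (m≤n⊔m (triangleBound (suc s)) _)) s<ws
      two<ws {zero}  _   len≤0 = contradiction (<-≤-trans (member⇒nonempty g∈) len≤0) (<-irrefl refl)

      pal′ : Palette (gs without g) ws
      pal′ {v} {w} v∈ w∈ v≢w =
        let v∈rest , xv≡g = inWs v∈
            w∈rest , xw≡g = inWs w∈
            v∈xs , v≢x , _ = inRest v∈rest
            w∈xs , w≢x , _ = inRest w∈rest
            t , t∈ = ∃-member (length-without-> (without-unique uws) (length-without-> uws (two<ws r<ws gs′≤)))
            t∈′ , t≢w = ∈-without⁻ (ws without v) t∈
            t∈ws , t≢v = ∈-without⁻ ws t∈′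
            t∈rest , xt≡g = inWs t∈ws
            _ , t≢x , _ = inRest t∈rest
        in ∈-without⁺ (pal v∈xs w∈xs v≢w) λ vw≡g →
             noPaw (paw ((v≢x ∘ sym ∷ w≢x ∘ sym ∷ t≢x ∘ sym ∷ []) ∷ (v≢w ∷ t≢v ∘ sym ∷ []) ∷ (t≢w ∘ sym ∷ []) ∷ [] ∷ [])
               (trans xv≡g (sym xw≡g)) (trans xv≡g (sym xt≡g)) (trans xv≡g (sym vw≡g)))

-- Copies of paths and paws in a coloured complete graph

injectionCopy : ∀ {H n} (f : Graph.Vertex H → Fin n) → (∀ {u v} → f u ≡ f v → u ≡ v) → Copy H (K n)
injectionCopy {H} f f-inj = record
  { map     = f
  ; map-inj = f-inj
  ; map-adj = λ e eq → Graph.adj-irr H (f-inj eq) e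
  }

unique? : ∀ {m} (xs : List (Fin m)) → Dec (Unique xs)
unique? = allPairs? (λ x y → ¬? (x Fin.≟ y))

module CompleteColouring {n k : ℕ} (c : EdgeColouring (suc k) (K n)) where

  open EdgeColouring c

  -- Total version of colour, with the junk value zero on the diagonal.
  χ : Fin n → Fin n → Fin (suc k)
  χ u v with u Fin.≟ v
  ... | yes _  = zero
  ... | no u≢v = colour u v u≢v

  χ-colour : ∀ {u v} (u≢v : u ≢ v) → χ u v ≡ colour u v u≢v
  χ-colour {u} {v} u≢v with u Fin.≟ v
  ... | yes u≡v = contradiction u≡v u≢v
  ... | no  _   = refl

  χ-sym : ∀ u v → χ u v ≡ χ v u
  χ-sym u v = bySym (u Fin.≟ v)
    where
    bySym : Dec (u ≡ v) → χ u v ≡ χ v u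
    bySym (yes refl) = refl
    bySym (no u≢v)   = trans (χ-colour u≢v) (trans (colour-sym u≢v (u≢v ∘ sym)) (sym (χ-colour (u≢v ∘ sym))))

  χ-exact : Exact c → ∀ a → ∃₂ λ u v → u ≢ v × χ u v ≡ a
  χ-exact exact a =
    let u , v , u≢v , eq = exact a in u , v , u≢v , trans (χ-colour u≢v) eq

  open Hues χ

  length-hues : ∀ {vs i} → suc i < length vs → i < length (hues vs)
  length-hues {_ ∷ _ ∷ _} {zero}  _         = s≤s z≤n
  length-hues {_ ∷ v ∷ vs} {suc i} (s≤s i<n) = s≤s (length-hues {v ∷ vs} i<n)
  length-hues {_ ∷ []}            (s≤s ())

  at-hues : ∀ {h₀ x₀ vs i} → suc i < length vs → at h₀ (hues vs) i ≡ χ (at x₀ vs i) (at x₀ vs (suc i))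
  at-hues {vs = _ ∷ []}            (s≤s ())
  at-hues {vs = _ ∷ _ ∷ _} {zero}  _         = refl
  at-hues {vs = _ ∷ v ∷ vs} {suc i} (s≤s i<n) = at-hues {vs = v ∷ vs} i<n

  -- An edge of the path is fixed, up to orientation, by its position in `hues vs`, and distinct
  -- hues determine the position. The default `v₀` is never read.
  rainbowCopy : ∀ v₀ vs → RainbowPath vs → Σ (Copy (P (length vs)) (K n)) (λ f → Rainbow (restrict c f))
  rainbowCopy v₀ vs (distinct , rainbow) = f , f-rainbow
    where
    f : Copy (P (length vs)) (K n)
    f = injectionCopy {P (length vs)} (at v₀ vs ∘ toℕ)
          (λ eq → Fin.toℕ-injective (at-injective distinct (Fin.toℕ<n _) (Fin.toℕ<n _) eq))

    w : Fin (length vs) → Fin n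
    w = at v₀ vs ∘ toℕ

    open EdgeColouring (restrict c f) renaming (colour to colour′)

    OnEdge : ℕ → Fin (length vs) → Fin (length vs) → Set
    OnEdge i u v = (toℕ u ≡ i × toℕ v ≡ suc i) ⊎ (toℕ u ≡ suc i × toℕ v ≡ i)

    edgeHue : ∀ {u v} (e : Graph.Adj (P (length vs)) u v) →
              ∃[ i ] i < length (hues vs) × colour′ u v e ≡ at zero (hues vs) i × OnEdge i u v
    edgeHue {u} {v} e@(inj₁ v≡1+u) =
      toℕ u , length-hues {vs} 1+u<n ,
      trans (sym (χ-colour (Copy.map-adj f e))) (trans (cong (χ (w u) ∘ at v₀ vs) v≡1+u) (sym (at-hues {x₀ = v₀} {vs} 1+u<n))) ,
      inj₁ (refl , v≡1+u)
      where
      1+u<n : suc (toℕ u) < length vs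
      1+u<n = subst (_< length vs) v≡1+u (Fin.toℕ<n v)
    edgeHue {u} {v} e@(inj₂ u≡1+v) =
      toℕ v , length-hues {vs} 1+v<n ,
      trans (sym (χ-colour (Copy.map-adj f e)))
        (trans (χ-sym (w u) (w v)) (trans (cong (χ (w v) ∘ at v₀ vs) u≡1+v) (sym (at-hues {x₀ = v₀} {vs} 1+v<n)))) ,
      inj₂ (u≡1+v , refl)
      where
      1+v<n : suc (toℕ v) < length vs
      1+v<n = subst (_< length vs) u≡1+v (Fin.toℕ<n u)

    sameEnd : ∀ {u x : Fin (length vs)} {i} → toℕ u ≡ i → toℕ x ≡ i → u ≡ x
    sameEnd p q = Fin.toℕ-injective (trans p (sym q))

    f-rainbow : Rainbow (restrict c f)
    f-rainbow e e′ eq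
      with i , i< , ei , on ← edgeHue e
      with j , j< , ej , on′ ← edgeHue e′
      with refl ← at-injective rainbow i< j< (trans (sym ei) (trans eq ej))
      with on | on′
    ... | inj₁ (p , q) | inj₁ (p′ , q′) = inj₁ (sameEnd p p′ , sameEnd q q′)
    ... | inj₁ (p , q) | inj₂ (p′ , q′) = inj₂ (sameEnd p q′ , sameEnd q p′)
    ... | inj₂ (p , q) | inj₁ (p′ , q′) = inj₂ (sameEnd p q′ , sameEnd q p′)
    ... | inj₂ (p , q) | inj₂ (p′ , q′) = inj₁ (sameEnd p p′ , sameEnd q q′)

  monochromaticCopy : ∀ {a b d e} → Paw a b d e → Σ (Copy (S 4 1) (K n)) (λ f → Monochromatic (restrict c f))
  monochromaticCopy {a} {b} {d} {e} (paw distinct ab≡ad ab≡ae ab≡bd) =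
    f , χ a b , λ {u} {v} edge → trans (sym (χ-colour (Copy.map-adj f edge)))
      ([ (λ arc → arcHue u v arc refl refl)
       , (λ arc → trans (χ-sym (w u) (w v)) (arcHue v u arc refl refl)) ]′ edge)
    where
    vs : List (Fin n)
    vs = a ∷ b ∷ d ∷ e ∷ []

    w : Fin 4 → Fin n
    w = at a vs ∘ toℕ

    f : Copy (S 4 1) (K n)
    f = injectionCopy {S 4 1} w
          (λ eq → Fin.toℕ-injective (at-injective distinct (Fin.toℕ<n _) (Fin.toℕ<n _) eq))

    arcHue : ∀ (u v : Fin 4) {i j} → StarArc 1 i j → i ≡ toℕ u → j ≡ toℕ v → χ (w u) (w v) ≡ χ a b
    arcHue zero       (suc zero)             spoke             refl refl = refl
    arcHue zero       (suc (suc zero))       spoke             refl refl = sym ab≡ad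
    arcHue zero       (suc (suc (suc zero))) spoke             refl refl = sym ab≡ae
    arcHue (suc zero) (suc (suc zero))       (extra (s≤s z≤n)) refl refl = sym ab≡bd

  private
    P₅? : Dec (∃[ v₁ ] ∃[ v₂ ] ∃[ v₃ ] ∃[ v₄ ] ∃[ v₅ ] RainbowPath (v₁ ∷ v₂ ∷ v₃ ∷ v₄ ∷ v₅ ∷ []))
    P₅? = Fin.any? λ v₁ → Fin.any? λ v₂ → Fin.any? λ v₃ → Fin.any? λ v₄ → Fin.any? λ v₅ →
            unique? (v₁ ∷ v₂ ∷ v₃ ∷ v₄ ∷ v₅ ∷ []) ×-dec unique? (hues (v₁ ∷ v₂ ∷ v₃ ∷ v₄ ∷ v₅ ∷ []))

    paw? : Dec (∃[ a ] ∃[ b ] ∃[ d ] ∃[ e ] Paw a b d e)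
    paw? = Fin.any? λ a → Fin.any? λ b → Fin.any? λ d → Fin.any? λ e →
             map′ (λ (u , p , q , r) → paw u p q r) (λ (paw u p q r) → u , p , q , r)
               (unique? (a ∷ b ∷ d ∷ e ∷ []) ×-dec (χ a b Fin.≟ χ a d) ×-dec (χ a b Fin.≟ χ a e) ×-dec (χ a b Fin.≟ χ b d))

  Unavoidable : Set
  Unavoidable = (Σ (Copy (P 5) (K n)) λ f → Rainbow (restrict c f)) ⊎
                (Σ (Copy (S 4 1) (K n)) λ f → Monochromatic (restrict c f))

  -- Both configurations are decidable by running through all tuples of vertices, so refuting their
  -- joint absence yields an actual copy.
  unavoidable : ((∀ vs → length vs ≡ 5 → ¬ RainbowPath vs) → (∀ {a b d e} → ¬ Paw a b d e) → ⊥) → Unavoidable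
  unavoidable forced with P₅? | paw?
  ... | yes (v₁ , v₂ , v₃ , v₄ , v₅ , path) | _ = inj₁ (rainbowCopy v₁ (v₁ ∷ v₂ ∷ v₃ ∷ v₄ ∷ v₅ ∷ []) path)
  ... | no _ | yes (_ , _ , _ , _ , p) = inj₂ (monochromaticCopy p)
  ... | no noP₅ | no noPaw = ⊥-elim (forced
    (λ { (v₁ ∷ v₂ ∷ v₃ ∷ v₄ ∷ v₅ ∷ []) refl path → noP₅ (v₁ , v₂ , v₃ , v₄ , v₅ , path) })
    (λ p → noPaw (_ , _ , _ , _ , p)))

  unavoidable-≥4 : Exact c → (6 ≤ n × 4 ≤ suc k) ⊎ (5 ≤ n × 5 ≤ suc k) → Unavoidable
  unavoidable-≥4 exact large = unavoidable (Forcing.rainbowP₅-or-paw χ χ-sym (χ-exact exact) large)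

  unavoidable-pawBound : pawBound (suc k) < n → Unavoidable
  unavoidable-pawBound large = unavoidable λ _ noPaw →
    Ramsey.pawFree⇒⊥ χ χ-sym noPaw (suc k) (allFin (suc k)) (allFin n) (≤-reflexive (length-allFin (suc k)))
      (subst (pawBound (suc k) <_) (sym (length-allFin n)) large) (Unique.allFin⁺ n) (λ _ _ _ → ∈-allFin _)
    where
    length-allFin : ∀ m → length (allFin m) ≡ m
    length-allFin m = length-tabulate id

-- Lower bounds

module _ {k : ℕ} {G H : Graph} {n : ℕ} (c : EdgeColouring k (K n)) where

  avoiding⇒< : Exact c → (∀ (f : Copy G (K n)) → ¬ Rainbow (restrict c f)) →
               (∀ (f : Copy H (K n)) → ¬ Monochromatic (restrict c f)) →
               ∀ M → GallaiRamseyBound k G H M → n < M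
  avoiding⇒< exact noG noH M (_ , unavoidable) = ≰⇒> λ M≤n →
    [ (λ (f , r) → noG f r) , (λ (f , m) → noH f m) ]′ (unavoidable n M≤n c exact)

module Table {n k : ℕ} (t : Fin n → Fin n → Fin k) (t-sym : ∀ u v → t u v ≡ t v u) where

  colouring : EdgeColouring k (K n)
  colouring = record { colour = λ u v _ → t u v ; colour-sym = λ {u} {v} _ _ → t-sym u v }

  -- Vertices 0, 1, 2 of `S 4 1` span its triangle. Being triangle-free is a condition on triples
  -- only, which suits a check by evaluation.
  noTriangle⇒noPaw : (∀ u v w → u ≢ v → u ≢ w → v ≢ w → t u v ≡ t u w → t u v ≢ t v w) →
                     ∀ (f : Copy (S 4 1) (K n)) → ¬ Monochromatic (restrict colouring f)
  noTriangle⇒noPaw noTriangle f (a , mono) =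
    noTriangle (φ 0F) (φ 1F) (φ 2F) (distinct λ ()) (distinct λ ()) (distinct λ ())
      (trans 01≡a (sym 02≡a)) (trans 01≡a (sym 12≡a))
    where
    open Copy f renaming (map to φ)

    distinct : ∀ {u v} → u ≢ v → φ u ≢ φ v
    distinct u≢v = u≢v ∘ map-inj

    01≡a = mono {0F} {1F} (inj₁ spoke)
    02≡a = mono {0F} {2F} (inj₁ spoke)
    12≡a = mono {1F} {2F} (inj₁ (extra (s≤s z≤n)))

  pathHues : ∀ {m} → Copy (P (suc m)) (K n) → Fin m → Fin k
  pathHues f i = t (Copy.map f (inject₁ i)) (Copy.map f (suc i))

  pathHues-injective : ∀ {m} (f : Copy (P (suc m)) (K n)) → Rainbow (restrict colouring f) →
                       ∀ {i j} → pathHues f i ≡ pathHues f j → i ≡ j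
  pathHues-injective {m} f rainbow {i} {j} eq with rainbow (arc i) (arc j) eq
    where
    arc : ∀ i → Graph.Adj (P (suc m)) (inject₁ i) (suc i)
    arc i = inj₁ (cong suc (sym (Fin.toℕ-inject₁ i)))
  ... | inj₁ (p , _) = Fin.inject₁-injective p
  -- Matching with reversed orientation would mean both `i = j + 1` and `i + 1 = j`.
  ... | inj₂ (p , q) = contradiction
    (trans (sym (Fin.toℕ-inject₁ i)) (cong toℕ p))
    (<⇒≢ (≤-trans (≤-reflexive (trans (cong toℕ q) (Fin.toℕ-inject₁ j))) (n≤1+n _)))

-- Extremal colourings, verified by evaluation

Triangle-free? : ∀ {n k} (t : Fin n → Fin n → Fin k) →
                 Dec (∀ u v w → u ≢ v → u ≢ w → v ≢ w → t u v ≡ t u w → t u v ≢ t v w)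
Triangle-free? t = Fin.all? λ u → Fin.all? λ v → Fin.all? λ w →
  ¬? (u Fin.≟ v) →-dec ¬? (u Fin.≟ w) →-dec ¬? (v Fin.≟ w) →-dec (t u v Fin.≟ t u w) →-dec ¬? (t u v Fin.≟ t v w)

Symmetric? : ∀ {n k} (t : Fin n → Fin n → Fin k) → Dec (∀ u v → t u v ≡ t v u)
Symmetric? t = Fin.all? λ u → Fin.all? λ v → t u v Fin.≟ t v u

Exact? : ∀ {n k} (t : Fin n → Fin n → Fin k) → Dec (∀ a → ∃[ u ] ∃[ v ] u ≢ v × t u v ≡ a)
Exact? t = Fin.all? λ a → Fin.any? λ u → Fin.any? λ v → ¬? (u Fin.≟ v) ×-dec (t u v Fin.≟ a)

entry : ∀ {n k} → List (List (Fin (suc k))) → Fin n → Fin n → Fin (suc k)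
entry rows u v = at zero (at [] rows (toℕ u)) (toℕ v)

-- Addition of vectors over GF(2), written as the lowest `b` binary digits.
xor : ℕ → ℕ → ℕ → ℕ
xor zero    m n = 0
xor (suc b) m n = (m + n) % 2 + 2 * xor b (m / 2) (n / 2)

-- Vertices are the elements of GF(16) = GF(2)[x]/(x⁴ + x + 1), and the hue of
-- uv is the coset of u − v modulo the cubes; no coset contains a solution of
-- a + b = c.
t₁₆ : Fin 16 → Fin 16 → Fin 3
t₁₆ u v = at zero (0F ∷ 0F ∷ 1F ∷ 1F ∷ 2F ∷ 2F ∷ 2F ∷ 1F ∷ 0F ∷ 2F ∷ 0F ∷ 1F ∷ 0F ∷ 1F ∷ 2F ∷ 0F ∷ [])
            (xor 4 (toℕ u) (toℕ v))

-- Diagonal entries of this and the following tables are junk.  Hue i ≤ 2 is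
-- borne by the edges from i to 3 and 4 and by the edge between the other two of
-- 0, 1, 2; the edge from 3 to 4 alone has hue 3.
t₅ : Fin 5 → Fin 5 → Fin 4
t₅ = entry ( (0F ∷ 2F ∷ 1F ∷ 0F ∷ 0F ∷ [])
           ∷ (2F ∷ 0F ∷ 0F ∷ 1F ∷ 1F ∷ [])
           ∷ (1F ∷ 0F ∷ 0F ∷ 2F ∷ 2F ∷ [])
           ∷ (0F ∷ 1F ∷ 2F ∷ 0F ∷ 3F ∷ [])
           ∷ (0F ∷ 1F ∷ 2F ∷ 3F ∷ 0F ∷ []) ∷ [])

-- The six edges share five hues: hue 0 is repeated, on two disjoint edges.
t₄ : Fin 4 → Fin 4 → Fin 5
t₄ = entry ( (0F ∷ 0F ∷ 1F ∷ 2F ∷ [])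
           ∷ (0F ∷ 0F ∷ 3F ∷ 4F ∷ [])
           ∷ (1F ∷ 3F ∷ 0F ∷ 0F ∷ [])
           ∷ (2F ∷ 4F ∷ 0F ∷ 0F ∷ []) ∷ [])

t₄′ : Fin 4 → Fin 4 → Fin 6
t₄′ = entry ( (0F ∷ 0F ∷ 1F ∷ 2F ∷ [])
            ∷ (0F ∷ 0F ∷ 3F ∷ 4F ∷ [])
            ∷ (1F ∷ 3F ∷ 0F ∷ 5F ∷ [])
            ∷ (2F ∷ 4F ∷ 5F ∷ 0F ∷ []) ∷ [])

lower₃ : ∀ M → GallaiRamseyBound 3 (P 5) (S 4 1) M → 17 ≤ M
lower₃ = avoiding⇒< colouring
  (λ a → let u , v , u≢v , eq = toWitness {a? = Exact? t₁₆} _ a in u , v , u≢v , eq)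
  -- The four edges of a rainbow P₅ would need four of the three hues.
  (λ f rainbow → <⇒≱ (≤ᵇ⇒≤ 4 4 _) (Fin.injective⇒≤ (pathHues-injective f rainbow)))
  (noTriangle⇒noPaw (toWitness {a? = Triangle-free? t₁₆} _))
  where open Table t₁₆ (toWitness {a? = Symmetric? t₁₆} _)

lower₄ : ∀ M → GallaiRamseyBound 4 (P 5) (S 4 1) M → 6 ≤ M
lower₄ = avoiding⇒< colouring
  (λ a → let u , v , u≢v , eq = toWitness {a? = Exact? t₅} _ a in u , v , u≢v , eq)
  (λ f rainbow → toWitness {a? = noRainbow?} _ _ _ _ _ _
     (Unique.map⁺ (Copy.map-inj f) (Unique.allFin⁺ 5))
     (Unique.map⁺ (pathHues-injective f rainbow) (Unique.allFin⁺ 4)))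
  (noTriangle⇒noPaw (toWitness {a? = Triangle-free? t₅} _))
  where
  open Table t₅ (toWitness {a? = Symmetric? t₅} _)
  open Hues t₅

  noRainbow? : Dec (∀ v₁ v₂ v₃ v₄ v₅ → Unique (v₁ ∷ v₂ ∷ v₃ ∷ v₄ ∷ v₅ ∷ []) →
                    ¬ Unique (hues (v₁ ∷ v₂ ∷ v₃ ∷ v₄ ∷ v₅ ∷ [])))
  noRainbow? = Fin.all? λ v₁ → Fin.all? λ v₂ → Fin.all? λ v₃ → Fin.all? λ v₄ → Fin.all? λ v₅ →
    unique? (v₁ ∷ v₂ ∷ v₃ ∷ v₄ ∷ v₅ ∷ []) →-dec ¬? (unique? (hues (v₁ ∷ v₂ ∷ v₃ ∷ v₄ ∷ v₅ ∷ [])))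

-- Hence a colouring of `K 4` only has to avoid monochromatic paws.
noP₅inK₄ : Copy (P 5) (K 4) → ⊥
noP₅inK₄ f = <⇒≱ (≤ᵇ⇒≤ 5 5 _) (Fin.injective⇒≤ (Copy.map-inj f))

lower₅ : ∀ M → GallaiRamseyBound 5 (P 5) (S 4 1) M → 5 ≤ M
lower₅ = avoiding⇒< colouring
  (λ a → let u , v , u≢v , eq = toWitness {a? = Exact? t₄} _ a in u , v , u≢v , eq)
  (λ f _ → noP₅inK₄ f)
  (noTriangle⇒noPaw (toWitness {a? = Triangle-free? t₄} _))
  where open Table t₄ (toWitness {a? = Symmetric? t₄} _)

lower₆ : ∀ M → GallaiRamseyBound 6 (P 5) (S 4 1) M → 5 ≤ M
lower₆ = avoiding⇒< colouring
  (λ a → let u , v , u≢v , eq = toWitness {a? = Exact? t₄′} _ a in u , v , u≢v , eq)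
  (λ f _ → noP₅inK₄ f)
  (noTriangle⇒noPaw (toWitness {a? = Triangle-free? t₄′} _))
  where open Table t₄′ (toWitness {a? = Symmetric? t₄′} _)

-- The interval of the triangular numbers containing k

1+n-C-2 : ∀ n → suc n C 2 ≡ n + n C 2
1+n-C-2 n = trans (sym (nCk+nC[k+1]≡[n+1]C[k+1] n 1)) (cong (_+ n C 2) (nC1≡n n))

C-2-mono : ∀ {m n} → m ≤ n → m C 2 ≤ n C 2
C-2-mono m≤n = go (≤⇒≤′ m≤n)
  where
  go : ∀ {m n} → m ≤′ n → m C 2 ≤ n C 2
  go ≤′-refl                 = ≤-refl
  go {n = suc n} (≤′-step p) = ≤-trans (go p) (≤-trans (m≤n+m _ n) (≤-reflexive (sym (1+n-C-2 n))))

-- If `M < ℓ`, monotonicity gives `M C 2 ≤ (ℓ ∸ 1) C 2 < k`.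
C-2-least : ∀ {k ℓ M} → (ℓ ∸ 1) C 2 + 1 ≤ k → k ≤ M C 2 → ℓ ≤ M
C-2-least {k} {ℓ} {M} low high = ≮⇒≥ λ M<ℓ → <-irrefl refl
  (≤-trans (s≤s (C-2-mono (∸-monoˡ-≤ 1 M<ℓ))) (≤-trans (≤-reflexive (+-comm 1 _)) (≤-trans low high)))

-- The intervals with `ℓ ≥ 5` start at `4 C 2 + 1 = 7`. As `k` grows by one, `ℓ` is kept until
-- `ℓ C 2` is exceeded, and then `suc ℓ` takes over.
∃-ℓ : ∀ d → ∃[ ℓ ] 5 ≤ ℓ × (ℓ ∸ 1) C 2 + 1 ≤ 7 + d × 7 + d ≤ ℓ C 2
∃-ℓ zero = 5 , ≤-refl , ≤-refl , ≤ᵇ⇒≤ 7 10 _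
∃-ℓ (suc d) with ℓ , 5≤ℓ , low , high ← ∃-ℓ d with 8 + d ≤? ℓ C 2
... | yes high′ = ℓ , 5≤ℓ , m≤n⇒m≤1+n low , high′
... | no  ¬high = suc ℓ , m≤n⇒m≤1+n 5≤ℓ
                , ≤-trans (≤-reflexive (+-comm (ℓ C 2) 1)) (≰⇒> ¬high)
                , ≤-trans (s≤s high) (≤-trans (+-monoˡ-≤ (ℓ C 2) (≤-trans (s≤s z≤n) 5≤ℓ)) (≤-reflexive (sym (1+n-C-2 ℓ))))

-- Upper bounds and the values of the Gallai-Ramsey numbers

upper₃ : GallaiRamseyBound 3 (P 5) (S 4 1) 17
-- `pawBound 3` evaluates to 16, the maximum of `triangleBound 3 = 16` and `3 + 2 * 6 = 15`.
upper₃ = ≤ᵇ⇒≤ 3 136 _ , λ n 17≤n c _ → CompleteColouring.unavoidable-pawBound c 17≤n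

upper₄ : GallaiRamseyBound 4 (P 5) (S 4 1) 6
upper₄ = ≤ᵇ⇒≤ 4 15 _ , λ n 6≤n c exact → CompleteColouring.unavoidable-≥4 c exact (inj₁ (6≤n , ≤-refl))

upper₅ : ∀ {k N} → 5 ≤ k → 5 ≤ N → k ≤ N C 2 → GallaiRamseyBound k (P 5) (S 4 1) N
upper₅ {suc k} 5≤k 5≤N k≤ = k≤ , λ n N≤n c exact →
  CompleteColouring.unavoidable-≥4 c exact (inj₂ (≤-trans 5≤N N≤n , 5≤k))

theorem3p6 : ∀ (k : ℕ) → 3 ≤ k →
    ∃[ N ] ( (gr[ k , P 5 ∶ S 4 1 ]≡ N)
    × (k ≡ 3 → N ≡ 17)
    × (k ≡ 4 → N ≡ 6)
    × (k ≡ 5 ⊎ k ≡ 6 → N ≡ 5)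
    × (∀ (ℓ : ℕ) → 5 ≤ ℓ → (ℓ ∸ 1) C 2 + 1 ≤ k → k ≤ ℓ C 2 → N ≡ ℓ) )
theorem3p6 1 (s≤s ())
theorem3p6 2 (s≤s (s≤s ()))
theorem3p6 3 _ = 17 , (upper₃ , lower₃) , (λ _ → refl) , (λ ()) , (λ { (inj₁ ()) ; (inj₂ ()) }) ,
  -- For `k ≤ 6 = 4 C 2` the interval condition would force `ℓ ≤ 4`, so the last clause is vacuous;
  -- the same holds for `k` = 4, 5, 6.
  λ ℓ 5≤ℓ low _ → contradiction (C-2-least {ℓ = ℓ} {4} low (≤ᵇ⇒≤ 3 6 _)) (<⇒≱ 5≤ℓ)
theorem3p6 4 _ = 6 , (upper₄ , lower₄) , (λ ()) , (λ _ → refl) , (λ { (inj₁ ()) ; (inj₂ ()) }) ,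
  λ ℓ 5≤ℓ low _ → contradiction (C-2-least {ℓ = ℓ} {4} low (≤ᵇ⇒≤ 4 6 _)) (<⇒≱ 5≤ℓ)
theorem3p6 5 _ = 5 , (upper₅ ≤-refl ≤-refl (≤ᵇ⇒≤ 5 10 _) , lower₅) , (λ ()) , (λ ()) , (λ _ → refl) ,
  λ ℓ 5≤ℓ low _ → contradiction (C-2-least {ℓ = ℓ} {4} low (≤ᵇ⇒≤ 5 6 _)) (<⇒≱ 5≤ℓ)
theorem3p6 6 _ = 5 , (upper₅ (≤ᵇ⇒≤ 5 6 _) ≤-refl (≤ᵇ⇒≤ 6 10 _) , lower₆) , (λ ()) , (λ ()) , (λ _ → refl) ,
  λ ℓ 5≤ℓ low _ → contradiction (C-2-least {ℓ = ℓ} {4} low (≤ᵇ⇒≤ 6 6 _)) (<⇒≱ 5≤ℓ)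
theorem3p6 (suc (suc (suc (suc (suc (suc (suc d))))))) _
  with N , 5≤N , low , high ← ∃-ℓ d =
  N , (upper₅ (m≤m+n 5 (2 + d)) 5≤N high , (λ M bound → C-2-least {ℓ = N} low (proj₁ bound))) ,
  (λ ()) , (λ ()) , (λ { (inj₁ ()) ; (inj₂ ()) }) ,
  -- The intervals are disjoint: `N` and `ℓ` each bound the other by leastness.
  λ ℓ _ low′ high′ → ≤-antisym (C-2-least {ℓ = N} low high′) (C-2-least {ℓ = ℓ} low′ high)
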